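{- The Parikh coverability problem is undecidable for asynchronous QDAS with at least one serial queue.
   Context: A queue-dispatch asynchronous system (QDAS) $\mathcal A$ consists of: a finite data domain $\mathbb D$ with an initial value $d_0$; a finite set $\mathcal X$ of variables ranging over $\mathbb D$; disjoint finite sets $CQID$ (concurrent queues) and $SQID$ (serial queues); a finite set $\Gamma$ of blocks with a distinguished initial block $main$; and for each block $\gamma\in\Gamma$ a finite labelled transition system with state set $S_\gamma$, initial state $s^0_\gamma$, a distinguished final state $f_\gamma\in S_\gamma$, and transitions $\Delta_\gamma\subseteq S_\gamma\times\Sigma\times S_\gamma$. The state sets are pairwise disjoint and $S=\bigcup_\gamma S_\gamma$. The actions $\Sigma$ are: asynchronous dispatches $\mathrm{dispatch_a}(q,\gamma)$ and synchronous dispatches $\mathrm{dispatch_s}(q,\gamma)$ with $q\in CQID\cup SQID$, $\gamma\in\Gamma\setminus\{main\}$; guards (finite conjunctions of atoms $x=d$, $x\neq d$); and assignments $x\gets d$. A configuration is a pair $(G,\mathbf d)$ of a valuation $\mathbf d:\mathcal X\to\mathbb D$ and a call-task graph $G$: a finite set of vertices, each being either a call vertex (a dispatched block waiting in a queue) or a task vertex (a running instance of a block), each labelled with a block $\lambda(v)$, the queue it was dispatched to (or a special identifier for $main$), and a state $state(v)\in S_{\lambda(v)}$ (call vertices carry the initial state of their block); the call vertices of each queue are ordered FIFO; and wait edges, where a wait edge $v\to w$ means $v$ is blocked until $w$ is removed. A task vertex is unblocked if it has no outgoing wait edge. The initial configuration has a single task vertex for $main$ in $s^0_{main}$ and all variables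 equal to $d_0$. Steps: an unblocked task vertex $v$ in state $s$ with $(s,a,s')\in\Delta_{\lambda(v)}$ moves to $s'$, where: a guard $a$ must be satisfied by $\mathbf d$; an assignment updates $\mathbf d$; $\mathrm{dispatch_a}(q,\gamma)$ appends a new call vertex for $\gamma$ at the end of queue $q$; $\mathrm{dispatch_s}(q,\gamma)$ does the same and adds a wait edge from $v$ to the new vertex. Scheduler steps: remove an unblocked task vertex $v$ with $state(v)=f_{\lambda(v)}$ (together with wait edges into it); turn the first call vertex of a concurrent queue into a task vertex; turn the first call vertex of a serial queue $q$ into a task vertex provided no task previously dequeued from $q$ is still present (so at most one task from a serial queue runs at a time). A configuration is reachable if it is obtained from the initial one by finitely many steps. The Parikh image $\mathrm{Parikh}(G):S\to\mathbb N$ maps $s$ to the number of vertices $v$ of $G$ with $state(v)=s$. The Parikh coverability problem: given a QDAS $\mathcal A$ and $f:S\to\mathbb N$, decide whether some reachable $(G,\mathbf d)$ satisfies $f(s)\le\mathrm{Parikh}(G)(s)$ for all $s\in S$. A QDAS is asynchronous if no transition is labelled by a synchronous dispatch. -}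

module Defs where

open import Data.Nat using (ℕ; zero; suc; _+_; _≤_)
import Data.Nat as ℕ
open import Data.Fin using (Fin; zero; suc)
import Data.Fin as F
open import Data.Bool using (Bool; true; false; if_then_else_)
open import Data.Maybe using (Maybe; just; nothing)
open import Data.Sum using (_⊎_; inj₁; inj₂)
import Data.Sum.Properties as SumP
open import Data.Product using (Σ; _×_; _,_; ∃; ∃-syntax)
import Data.Product.Properties as ProdP
open import Data.List using (List; []; _∷_; _++_; [_]; map; filter; length; allFin)
open import Data.Nat.ListAction using (sum)
open import Data.List.Membership.Propositional using (_∈_)
open import Data.List.Relation.Unary.All using (All)
open import Data.Empty using (⊥)
open import Data.Unit using (⊤)
open import Relation.Nullary using (¬_; Dec; yes; no; does)
open import Relation.Binary using (DecidableEquality)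
open import Relation.Binary.PropositionalEquality using (_≡_; _≢_)
open import Relation.Binary.Construct.Closure.ReflexiveTransitive using (Star)
open import Function.Bundles using (_⇔_)

-- Syntax of QDAS
--   data domain  𝔻 = Fin nD, variables 𝒳 = Fin nX,
--   CQID = Fin nC, SQID = Fin nS (disjoint via ⊎), blocks Γ = Fin nB.

Queue : ℕ → ℕ → Set
Queue nC nS = Fin nC ⊎ Fin nS

data Atom (nD nX : ℕ) : Set where
  eqA  : Fin nX → Fin nD → Atom nD nX
  neqA : Fin nX → Fin nD → Atom nD nX

data Action (nD nX nC nS nB : ℕ) : Set where
  dispatchA : Queue nC nS → Fin nB → Action nD nX nC nS nB
  dispatchS : Queue nC nS → Fin nB → Action nD nX nC nS nB
  guard     : List (Atom nD nX) → Action nD nX nC nS nB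
  assign    : Fin nX → Fin nD → Action nD nX nC nS nB

DispatchesTo : ∀ {nD nX nC nS nB} → Fin nB → Action nD nX nC nS nB → Set
DispatchesTo b (dispatchA q γ) = γ ≡ b
DispatchesTo b (dispatchS q γ) = γ ≡ b
DispatchesTo b (guard g)       = ⊥
DispatchesTo b (assign x d)    = ⊥

IsSyncDispatch : ∀ {nD nX nC nS nB} → Action nD nX nC nS nB → Set
IsSyncDispatch (dispatchS q γ) = ⊤
IsSyncDispatch (dispatchA q γ) = ⊥
IsSyncDispatch (guard g)       = ⊥
IsSyncDispatch (assign x d)    = ⊥

record QDAS : Set where
  field
    nD  : ℕ
    d₀  : Fin nD
    nX  : ℕ
    nC  : ℕ
    nS  : ℕ
    nB  : ℕ
    main  : Fin nB
    nSt   : Fin nB → ℕ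
    init  : (γ : Fin nB) → Fin (nSt γ)
    final : (γ : Fin nB) → Fin (nSt γ)
    trans : (γ : Fin nB) → List (Fin (nSt γ) × Action nD nX nC nS nB × Fin (nSt γ))
    noMainDispatch : ∀ γ {s a s'} → (s , a , s') ∈ trans γ → ¬ DispatchesTo main a

Asynchronous : QDAS → Set
Asynchronous A = ∀ γ {s a s'} → (s , a , s') ∈ QDAS.trans A γ → ¬ IsSyncDispatch a

module Semantics (A : QDAS) where
  open QDAS A

  Q : Set
  Q = Queue nC nS

  _≟Q_ : DecidableEquality Q
  _≟Q_ = SumP.≡-dec F._≟_ F._≟_

  -- S = ⋃_γ S_γ (disjoint union)
  S : Set
  S = Σ (Fin nB) (λ γ → Fin (nSt γ))

  _≟S_ : DecidableEquality S
  _≟S_ = ProdP.≡-dec F._≟_ F._≟_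

  Valuation : Set
  Valuation = Fin nX → Fin nD

  SatAtom : Valuation → Atom nD nX → Set
  SatAtom v (eqA x d)  = v x ≡ d
  SatAtom v (neqA x d) = v x ≢ d

  Sat : Valuation → List (Atom nD nX) → Set
  Sat v g = All (SatAtom v) g

  updV : Valuation → Fin nX → Fin nD → Valuation
  updV v x d y = if does (y F.≟ x) then d else v y

  -- call vertex: identifier and block (its state is s⁰ of its block)
  record Call : Set where
    constructor call
    field
      cid  : ℕ
      cblk : Fin nB

  -- task vertex: identifier, block, queue it was dispatched to
  -- (nothing = special identifier of main), current state, and its
  -- outgoing wait edge (identifier of the vertex it waits for), if any
  record Task : Set where
    field
      vid  : ℕ
      blk  : Fin nB
      src  : Maybe Q
      st   : Fin (nSt blk)
      wait : Maybe ℕ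
  open Task public

  -- call-task graph + valuation; the call vertices of each queue are
  -- kept as a FIFO list; `fresh` supplies unused vertex identifiers
  record Config : Set where
    constructor cfg
    field
      val    : Valuation
      tasks  : List Task
      queues : Q → List Call
      fresh  : ℕ

  setSt : (t : Task) → Fin (nSt (blk t)) → Task
  setSt t s = record t { st = s }

  setWait : Task → ℕ → Task
  setWait t i = record t { wait = just i }

  clearW : ℕ → Maybe ℕ → Maybe ℕ
  clearW i nothing  = nothing
  clearW i (just j) = if does (j ℕ.≟ i) then nothing else just j

  clear : ℕ → Task → Task
  clear i t = record t { wait = clearW i (wait t) }

  setQ : (Q → List Call) → Q → List Call → (Q → List Call)
  setQ qs q l q' = if does (q' ≟Q q) then l else qs q'

  enqueue : (Q → List Call) → Q → Call → (Q → List Call)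
  enqueue qs q c = setQ qs q (qs q ++ [ c ])

  startTask : Q → Call → Task
  startTask q (call i γ) = record
    { vid = i ; blk = γ ; src = just q ; st = init γ ; wait = nothing }

  Unblocked : Task → Set
  Unblocked t = wait t ≡ nothing

  infix 4 _⟶_
  data _⟶_ : Config → Config → Set where
    guardStep : ∀ {v xs t ys qs n g s'} → Unblocked t →
      (st t , guard g , s') ∈ trans (blk t) → Sat v g →
      cfg v (xs ++ t ∷ ys) qs n ⟶ cfg v (xs ++ setSt t s' ∷ ys) qs n
    assignStep : ∀ {v xs t ys qs n x d s'} → Unblocked t →
      (st t , assign x d , s') ∈ trans (blk t) →
      cfg v (xs ++ t ∷ ys) qs n ⟶ cfg (updV v x d) (xs ++ setSt t s' ∷ ys) qs n
    dispAStep : ∀ {v xs t ys qs n q γ s'} → Unblocked t →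
      (st t , dispatchA q γ , s') ∈ trans (blk t) →
      cfg v (xs ++ t ∷ ys) qs n ⟶
      cfg v (xs ++ setSt t s' ∷ ys) (enqueue qs q (call n γ)) (suc n)
    dispSStep : ∀ {v xs t ys qs n q γ s'} → Unblocked t →
      (st t , dispatchS q γ , s') ∈ trans (blk t) →
      cfg v (xs ++ t ∷ ys) qs n ⟶
      cfg v (xs ++ setWait (setSt t s') n ∷ ys) (enqueue qs q (call n γ)) (suc n)
    removeStep : ∀ {v xs t ys qs n} → Unblocked t → st t ≡ final (blk t) →
      cfg v (xs ++ t ∷ ys) qs n ⟶ cfg v (map (clear (vid t)) (xs ++ ys)) qs n
    deqCStep : ∀ {v ts qs n c k rest} → qs (inj₁ c) ≡ k ∷ rest →
      cfg v ts qs n ⟶ cfg v (startTask (inj₁ c) k ∷ ts) (setQ qs (inj₁ c) rest) n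
    deqSStep : ∀ {v ts qs n c k rest} → qs (inj₂ c) ≡ k ∷ rest →
      All (λ t → src t ≢ just (inj₂ c)) ts →
      cfg v ts qs n ⟶ cfg v (startTask (inj₂ c) k ∷ ts) (setQ qs (inj₂ c) rest) n

  mainTask : Task
  mainTask = record { vid = 0 ; blk = main ; src = nothing ; st = init main ; wait = nothing }

  initConfig : Config
  initConfig = cfg (λ _ → d₀) [ mainTask ] (λ _ → []) 1

  Reachable : Config → Set
  Reachable c = Star _⟶_ initConfig c

  allQueues : List Q
  allQueues = map inj₁ (allFin nC) ++ map inj₂ (allFin nS)

  taskState : Task → S
  taskState t = (blk t , st t)

  callState : Call → S
  callState (call i γ) = (γ , init γ)

  Parikh : Config → S → ℕ
  Parikh (cfg v ts qs n) s =
    length (filter (λ t → taskState t ≟S s) ts) +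
    sum (map (λ q → length (filter (λ k → callState k ≟S s) (qs q))) allQueues)

  Coverable : (S → ℕ) → Set
  Coverable f = ∃[ c ] (Reachable c × (∀ s → f s ≤ Parikh c s))

record Instance : Set where
  field
    qdas   : QDAS
    async  : Asynchronous qdas
    serial : 1 ≤ QDAS.nS qdas
    target : Semantics.S qdas → ℕ

InstanceCoverable : Instance → Set
InstanceCoverable I = Semantics.Coverable (Instance.qdas I) (Instance.target I)

-- Minsky two-counter machines (halting from state 0 with both counters 0
-- is the canonical undecidable problem used as reduction source)

data Instr (n : ℕ) : Set where
  inc  : Fin 2 → Fin n → Instr n
  jzdec : Fin 2 → Fin n → Fin n → Instr n        -- if c_i = 0 goto k else c_i-- ; goto j
  halt : Instr n

record CounterMachine : Set where
  field
    n    : ℕ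
    prog : Fin (suc n) → Instr (suc n)

module CMSem (M : CounterMachine) where
  open CounterMachine M

  MConf : Set
  MConf = Fin (suc n) × (Fin 2 → ℕ)

  updC : (Fin 2 → ℕ) → Fin 2 → ℕ → (Fin 2 → ℕ)
  updC c i m j = if does (j F.≟ i) then m else c j

  data _↦_ : MConf → MConf → Set where
    incS : ∀ {p c i j} → prog p ≡ inc i j → (p , c) ↦ (j , updC c i (suc (c i)))
    decS : ∀ {p c i j k m} → prog p ≡ jzdec i j k → c i ≡ suc m → (p , c) ↦ (j , updC c i m)
    zeroS : ∀ {p c i j k} → prog p ≡ jzdec i j k → c i ≡ 0 → (p , c) ↦ (k , c)

  Halts : Set
  Halts = ∃[ p ] ∃[ c ] (Star _↦_ (zero , λ _ → 0) (p , c) × prog p ≡ halt)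

Halts : CounterMachine → Set
Halts M = CMSem.Halts M

module Submission where

-- For a machine M, the QDAS built in Construction keeps M's configuration in its
-- serial queue: one token block per unit of each counter, and one control block,
-- the handler of the current location.  The handler of an increment enqueues a
-- token and the next handler.  The handler of a zero test on counter i sets the
-- single variable (the flag) to seek i and enqueues resume p behind all tokens;
-- while the queue rotates once, the first token of counter i consumes itself and
-- resets the flag, so resume p learns from the flag whether the counter was zero.
-- The handler of a halting location sets the flag to done, which lets main pass
-- into its state s₃; the target demands one vertex in that state.

open import Defs
open import Data.Nat using (ℕ; zero; suc; _+_; _≤_; z≤n; s≤s)
open import Data.Nat.ListAction using (sum)
open import Data.Nat.ListAction.Properties using (sum-↭)
import Data.Nat.Properties as ℕₚ
open import Data.Fin using (Fin; zero; suc; _↑ˡ_; _↑ʳ_; splitAt)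
import Data.Fin.Properties as Finₚ
open import Data.Bool using (if_then_else_)
open import Data.Sum using (_⊎_; inj₁; inj₂; [_,_]′)
open import Data.Product using (Σ; _×_; _,_; proj₁; proj₂)
open import Data.Maybe using (just; nothing)
open import Data.List using (List; []; _∷_; _++_; [_]; map; length)
open import Data.List.Properties
  using (++-assoc; ++-identityʳ; map-++; filter-none; ∷-injectiveˡ; ∷-injectiveʳ)
open import Data.List.Membership.Propositional using (_∈_)
open import Data.List.Relation.Unary.Any using (here; there)
open import Data.List.Relation.Unary.All as All using (All; []; _∷_; universal)
open import Data.List.Relation.Unary.All.Properties using (++⁺)
open import Data.List.Relation.Binary.Permutation.Propositional using (_↭_)
import Data.List.Relation.Binary.Permutation.Propositional.Properties as ↭
open import Data.Empty using (⊥; ⊥-elim)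
open import Data.Unit using (tt)
open import Function.Bundles using (_⇔_; mk⇔)
open import Relation.Nullary using (¬_; yes; no; does)
open import Relation.Binary.PropositionalEquality
  using (_≡_; _≢_; refl; sym; trans; cong; cong₂; subst; ≢-sym; module ≡-Reasoning)
open import Relation.Binary.Construct.Closure.ReflexiveTransitive using (Star; ε; _◅_; _◅◅_)

module Construction (M : CounterMachine) where
  open CounterMachine M using (prog)

  locs : ℕ
  locs = suc (CounterMachine.n M)

  Loc : Set
  Loc = Fin locs

  data Blk : Set where
    mainB   : Blk
    token   : Fin 2 → Blk   -- one unit in counter i
    handler : Loc → Blk     -- executes the instruction at location p
    resume  : Loc → Blk     -- decides the zero test started by handler p

  nBlocks : ℕ
  nBlocks = 3 + (locs + locs)

  code : Blk → Fin nBlocks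
  code mainB             = zero
  code (token zero)      = suc zero
  code (token (suc zero)) = suc (suc zero)
  code (handler p)       = suc (suc (suc (p ↑ˡ locs)))
  code (resume p)        = suc (suc (suc (locs ↑ʳ p)))

  decode : Fin nBlocks → Blk
  decode zero                = mainB
  decode (suc zero)          = token zero
  decode (suc (suc zero))    = token (suc zero)
  decode (suc (suc (suc r))) = [ handler , resume ]′ (splitAt locs r)

  decode-code : ∀ b → decode (code b) ≡ b
  decode-code mainB              = refl
  decode-code (token zero)       = refl
  decode-code (token (suc zero)) = refl
  decode-code (handler p) rewrite Finₚ.splitAt-↑ˡ locs p locs = refl
  decode-code (resume p)  rewrite Finₚ.splitAt-↑ʳ locs locs p = refl

  code-injective : ∀ {b b'} → code b ≡ code b' → b ≡ b'
  code-injective {b} {b'} e = trans (sym (decode-code b)) (trans (cong decode e) (decode-code b'))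

  -- The single variable, the flag, records what the running block is doing:
  -- idle, seeking a token of counter i (to decrement it), or done (M halted).
  Flag : Set
  Flag = Fin 4

  pattern idle = zero
  pattern done = suc (suc (suc zero))

  seek : Fin 2 → Flag
  seek zero       = suc zero
  seek (suc zero) = suc (suc zero)

  seek≢idle : ∀ {i} → seek i ≢ idle
  seek≢idle {zero} ()
  seek≢idle {suc zero} ()

  seek≢done : ∀ {i} → seek i ≢ done
  seek≢done {zero} ()
  seek≢done {suc zero} ()

  seek-injective : ∀ {i j} → seek i ≡ seek j → i ≡ j
  seek-injective {zero} {zero} _ = refl
  seek-injective {suc zero} {suc zero} _ = refl
  seek-injective {zero} {suc zero} ()
  seek-injective {suc zero} {zero} ()

  flag : Fin 1
  flag = zero

  -- Every block has the states s₀ (initial) … s₄, with s₁ final.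
  St : Set
  St = Fin 5

  pattern s₀ = zero
  pattern s₁ = suc zero
  pattern s₂ = suc (suc zero)
  pattern s₃ = suc (suc (suc zero))
  pattern s₄ = suc (suc (suc (suc zero)))

  serialQ : Queue 0 1
  serialQ = inj₂ zero

  Act : Set
  Act = Action 4 1 0 1 nBlocks

  dispatch : Blk → Act
  dispatch b = dispatchA serialQ (code b)

  ifFlag ifNotFlag : Flag → Act
  ifFlag d    = guard [ eqA flag d ]
  ifNotFlag d = guard [ neqA flag d ]

  setFlag : Flag → Act
  setFlag d = assign flag d

  -- The handler of an increment enqueues a token
  -- and the next handler; the handler of a zero test starts seeking a token and
  -- enqueues resume p behind the whole queue, which therefore meets the flag
  -- reset to idle exactly if a token was found.
  handlerTable : Loc → Instr locs → List (St × Act × St)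
  handlerTable p (inc i j)     = (s₀ , dispatch (token i) , s₂) ∷ (s₂ , dispatch (handler j) , s₁) ∷ []
  handlerTable p (jzdec i j k) = (s₀ , setFlag (seek i) , s₂) ∷ (s₂ , dispatch (resume p) , s₁) ∷ []
  handlerTable p halt          = (s₀ , setFlag done , s₁) ∷ []

  resumeTable : Instr locs → List (St × Act × St)
  resumeTable (jzdec i j k) =
    (s₀ , ifFlag idle , s₂) ∷ (s₂ , dispatch (handler j) , s₁) ∷
    (s₀ , ifFlag (seek i) , s₃) ∷ (s₃ , setFlag idle , s₄) ∷ (s₄ , dispatch (handler k) , s₁) ∷ []
  resumeTable (inc _ _) = []
  resumeTable halt      = []

  table : Blk → List (St × Act × St)
  table mainB       = (s₀ , dispatch (handler zero) , s₂) ∷ (s₂ , ifFlag done , s₃) ∷ []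
  table (token i)   = (s₀ , ifFlag (seek i) , s₃) ∷ (s₃ , setFlag idle , s₁) ∷
                      (s₀ , ifNotFlag (seek i) , s₂) ∷ (s₂ , dispatch (token i) , s₁) ∷ []
  table (handler p) = handlerTable p (prog p)
  table (resume p)  = resumeTable (prog p)

  -- The same table as an inductive relation, convenient for case analysis.
  data Tr : Blk → St → Act → St → Set where
    mainStart    : Tr mainB s₀ (dispatch (handler zero)) s₂
    mainWait     : Tr mainB s₂ (ifFlag done) s₃
    tokenHit     : ∀ {i} → Tr (token i) s₀ (ifFlag (seek i)) s₃
    tokenClear   : ∀ {i} → Tr (token i) s₃ (setFlag idle) s₁
    tokenMiss    : ∀ {i} → Tr (token i) s₀ (ifNotFlag (seek i)) s₂
    tokenRequeue : ∀ {i} → Tr (token i) s₂ (dispatch (token i)) s₁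
    incToken     : ∀ {p i j} → prog p ≡ inc i j → Tr (handler p) s₀ (dispatch (token i)) s₂
    incNext      : ∀ {p i j} → prog p ≡ inc i j → Tr (handler p) s₂ (dispatch (handler j)) s₁
    testStart    : ∀ {p i j k} → prog p ≡ jzdec i j k → Tr (handler p) s₀ (setFlag (seek i)) s₂
    testResume   : ∀ {p i j k} → prog p ≡ jzdec i j k → Tr (handler p) s₂ (dispatch (resume p)) s₁
    haltSignal   : ∀ {p} → prog p ≡ halt → Tr (handler p) s₀ (setFlag done) s₁
    decFound     : ∀ {p i j k} → prog p ≡ jzdec i j k → Tr (resume p) s₀ (ifFlag idle) s₂
    decNext      : ∀ {p i j k} → prog p ≡ jzdec i j k → Tr (resume p) s₂ (dispatch (handler j)) s₁
    zeroFound    : ∀ {p i j k} → prog p ≡ jzdec i j k → Tr (resume p) s₀ (ifFlag (seek i)) s₃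
    zeroClear    : ∀ {p i j k} → prog p ≡ jzdec i j k → Tr (resume p) s₃ (setFlag idle) s₄
    zeroNext     : ∀ {p i j k} → prog p ≡ jzdec i j k → Tr (resume p) s₄ (dispatch (handler k)) s₁

  table→Tr : ∀ b {s a s'} → (s , a , s') ∈ table b → Tr b s a s'
  table→Tr mainB (here refl)                                 = mainStart
  table→Tr mainB (there (here refl))                         = mainWait
  table→Tr (token i) (here refl)                             = tokenHit
  table→Tr (token i) (there (here refl))                     = tokenClear
  table→Tr (token i) (there (there (here refl)))             = tokenMiss
  table→Tr (token i) (there (there (there (here refl))))     = tokenRequeue
  table→Tr (handler p) t = handler→Tr (prog p) refl t
    where
    handler→Tr : ∀ I → prog p ≡ I → ∀ {s a s'} → (s , a , s') ∈ handlerTable p I →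
                 Tr (handler p) s a s'
    handler→Tr (inc i j) e (here refl)                 = incToken e
    handler→Tr (inc i j) e (there (here refl))         = incNext e
    handler→Tr (jzdec i j k) e (here refl)             = testStart e
    handler→Tr (jzdec i j k) e (there (here refl))     = testResume e
    handler→Tr halt e (here refl)                      = haltSignal e
  table→Tr (resume p) t = resume→Tr (prog p) refl t
    where
    resume→Tr : ∀ I → prog p ≡ I → ∀ {s a s'} → (s , a , s') ∈ resumeTable I → Tr (resume p) s a s'
    resume→Tr (jzdec i j k) e (here refl)                                 = decFound e
    resume→Tr (jzdec i j k) e (there (here refl))                         = decNext e
    resume→Tr (jzdec i j k) e (there (there (here refl)))                 = zeroFound e
    resume→Tr (jzdec i j k) e (there (there (there (here refl))))         = zeroClear e
    resume→Tr (jzdec i j k) e (there (there (there (there (here refl))))) = zeroNext e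

  Tr→table : ∀ {b s a s'} → Tr b s a s' → (s , a , s') ∈ table b
  Tr→table mainStart    = here refl
  Tr→table mainWait     = there (here refl)
  Tr→table tokenHit     = here refl
  Tr→table tokenClear   = there (here refl)
  Tr→table tokenMiss    = there (there (here refl))
  Tr→table tokenRequeue = there (there (there (here refl)))
  Tr→table (incToken e)   rewrite e = here refl
  Tr→table (incNext e)    rewrite e = there (here refl)
  Tr→table (testStart e)  rewrite e = here refl
  Tr→table (testResume e) rewrite e = there (here refl)
  Tr→table (haltSignal e) rewrite e = here refl
  Tr→table (decFound e)   rewrite e = here refl
  Tr→table (decNext e)    rewrite e = there (here refl)
  Tr→table (zeroFound e)  rewrite e = there (there (here refl))
  Tr→table (zeroClear e)  rewrite e = there (there (there (here refl)))
  Tr→table (zeroNext e)   rewrite e = there (there (there (there (here refl))))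

  tokenCode≢mainCode : ∀ {i} → code (token i) ≢ code mainB
  tokenCode≢mainCode {zero} ()
  tokenCode≢mainCode {suc zero} ()

  neverDispatchesMain : ∀ {b s a s'} → Tr b s a s' → ¬ DispatchesTo (code mainB) a
  neverDispatchesMain {a = guard _} _ ()
  neverDispatchesMain {a = assign _ _} _ ()
  neverDispatchesMain {a = dispatchS _ _} () _
  neverDispatchesMain mainStart ()
  neverDispatchesMain tokenRequeue e = tokenCode≢mainCode e
  neverDispatchesMain (incToken _) e = tokenCode≢mainCode e
  neverDispatchesMain (incNext _) ()
  neverDispatchesMain (testResume _) ()
  neverDispatchesMain (decNext _) ()
  neverDispatchesMain (zeroNext _) ()

  neverSynchronous : ∀ {b s a s'} → Tr b s a s' → ¬ IsSyncDispatch a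
  neverSynchronous {a = dispatchS _ _} () _
  neverSynchronous {a = dispatchA _ _} _ ()
  neverSynchronous {a = guard _} _ ()
  neverSynchronous {a = assign _ _} _ ()

  qdas : QDAS
  qdas = record
    { nD = 4 ; d₀ = idle ; nX = 1 ; nC = 0 ; nS = 1 ; nB = nBlocks ; main = code mainB
    ; nSt = λ _ → 5 ; init = λ _ → s₀ ; final = λ _ → s₁
    ; trans = λ γ → table (decode γ)
    ; noMainDispatch = λ γ t → neverDispatchesMain (table→Tr (decode γ) t) }

  asynchronous : Asynchronous qdas
  asynchronous γ t = neverSynchronous (table→Tr (decode γ) t)

  open Semantics qdas public

  transitionOf : ∀ b {s a s'} → (s , a , s') ∈ QDAS.trans qdas (code b) → Tr b s a s'
  transitionOf b t = subst (λ b' → Tr b' _ _ _) (decode-code b) (table→Tr (decode (code b)) t)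

  memberOf : ∀ {b s a s'} → Tr b s a s' → (s , a , s') ∈ QDAS.trans qdas (code b)
  memberOf {b} t = subst (λ b' → _ ∈ table b') (sym (decode-code b)) (Tr→table t)

  haltedState : S
  haltedState = (code mainB , s₃)

  target : S → ℕ
  target s = if does (s ≟S haltedState) then 1 else 0

  mainWaiting : Task
  mainWaiting = record mainTask { st = s₂ }

  serialTask : ℕ → Blk → St → Task
  serialTask i b s = record { vid = i ; blk = code b ; src = just serialQ ; st = s ; wait = nothing }

  Holds : List Call → List Blk → Set
  Holds L w = map Call.cblk L ≡ map code w

  holds-snoc : ∀ {L w} n b → Holds L w → Holds (L ++ [ call n (code b) ]) (w ++ [ b ])
  holds-snoc {L} {w} n b e =
    trans (map-++ Call.cblk L _) (trans (cong (_++ [ code b ]) e) (sym (map-++ code w [ b ])))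

module QueueWords (M : CounterMachine) where
  open CounterMachine M using (prog)
  open Construction M
  open CMSem M using (_↦_; incS; decS; zeroS; updC)

  Counters : Set
  Counters = Fin 2 → ℕ

  Reach : Loc → Counters → Set
  Reach p c = Star _↦_ (zero , λ _ → 0) (p , c)

  Progress : (Loc → Counters → Set) → Set
  Progress P = Σ Loc λ p → Σ Counters λ c → Reach p c × P p c

  δ : Fin 2 → Fin 2 → ℕ
  δ zero       zero       = 1
  δ zero       (suc zero) = 0
  δ (suc zero) zero       = 0
  δ (suc zero) (suc zero) = 1

  δ-same : ∀ i → δ i i ≡ 1
  δ-same zero       = refl
  δ-same (suc zero) = refl

  δ-diff : ∀ {i j} → i ≢ j → δ i j ≡ 0
  δ-diff {zero}     {zero}     ne = ⊥-elim (ne refl)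
  δ-diff {zero}     {suc zero} ne = refl
  δ-diff {suc zero} {zero}     ne = refl
  δ-diff {suc zero} {suc zero} ne = ⊥-elim (ne refl)

  weight : Fin 2 → Blk → ℕ
  weight i (token j) = δ i j
  weight i _         = 0

  count : Fin 2 → List Blk → ℕ
  count i w = sum (map (weight i) w)

  count-↭ : ∀ i {u w} → u ↭ w → count i u ≡ count i w
  count-↭ i π = sum-↭ (↭.map⁺ (weight i) π)

  count-snoc : ∀ i w b → count i (w ++ [ b ]) ≡ count i (b ∷ w)
  count-snoc i w b = count-↭ i (↭.++-comm w [ b ])

  count-middle : ∀ i u b w → count i (u ++ b ∷ w) ≡ count i (b ∷ u ++ w)
  count-middle i u b w = count-↭ i (↭.shift b u w)

  data IsToken : Blk → Set where
    isToken : ∀ i → IsToken (token i)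

  Tokens : List Blk → Set
  Tokens = All IsToken

  Represents : Counters → List Blk → Set
  Represents c W = ∀ i → c i ≡ count i W

  represents-rotate : ∀ {c} b w → Represents c (b ∷ w) → Represents c (w ++ [ b ])
  represents-rotate b w cn i = trans (cn i) (sym (count-snoc i w b))

  represents-update : ∀ {c} W i m → m ≡ count i W → (∀ j → j ≢ i → c j ≡ count j W) →
                      Represents (updC c i m) W
  represents-update W i m e others j with j Finₚ.≟ i
  ... | yes refl = e
  ... | no j≢i   = others j j≢i

  represents-addToken : ∀ {c} w i → Represents c w → Represents (updC c i (suc (c i))) (w ++ [ token i ])
  represents-addToken {c} w i cn =
    represents-update (w ++ [ token i ]) i (suc (c i)) (trans (cong suc (cn i)) (sym (added i (δ-same i))))
      (λ j j≢i → trans (cn j) (sym (added j (δ-diff j≢i))))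
    where
    added : ∀ j {n} → δ j i ≡ n → count j (w ++ [ token i ]) ≡ n + count j w
    added j e = trans (count-snoc j w (token i)) (cong (_+ count j w) e)

  count-token : ∀ {c} u i w → Represents c (u ++ token i ∷ w) → c i ≡ suc (count i (u ++ w))
  count-token u i w cn =
    trans (cn i) (trans (count-middle i u (token i) w) (cong (_+ count i (u ++ w)) (δ-same i)))

  represents-removeToken : ∀ {c} u i w {m} → Represents c (u ++ token i ∷ w) → c i ≡ suc m →
                           Represents (updC c i m) (u ++ w)
  represents-removeToken {c} u i w cn ci =
    represents-update (u ++ w) i _ (ℕₚ.suc-injective (trans (sym ci) (count-token u i w cn)))
      (λ j j≢i → trans (cn j) (trans (count-middle j u (token i) w)
                   (cong (_+ count j (u ++ w)) (δ-diff j≢i))))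

  firstToken : ∀ {w} i {m} → Tokens w → count i w ≡ suc m →
    Σ (List Blk) λ u → Σ (List Blk) λ v → w ≡ u ++ token i ∷ v × Tokens u × Tokens v × count i u ≡ 0
  firstToken i [] ()
  firstToken i (isToken j ∷ tw) e with j Finₚ.≟ i
  ... | yes refl = [] , _ , refl , [] , tw , refl
  ... | no j≢i with firstToken i tw (trans (cong (_+ _) (sym (δ-diff (≢-sym j≢i)))) e)
  ...   | u , v , refl , tu , tv , z =
          token j ∷ u , v , refl , isToken j ∷ tu , tv , trans (cong (_+ count i u) (δ-diff (≢-sym j≢i))) z

  -- The encoding invariant.  Besides tokens, a queue word contains exactly one
  -- control block, which determines the flag and the current location of M:
  data Control (x : Flag) (p : Loc) (after : List Blk) : Blk → Set where
    atHandler : x ≡ idle → Control x p after (handler p)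
    -- a zero test at p is seeking a token; none of counter i lies behind resume p
    seeking   : ∀ {i j k} → prog p ≡ jzdec i j k → x ≡ seek i → count i after ≡ 0 →
                Control x p after (resume p)
    -- the zero test at q has found (and consumed) a token; M moved on to p
    resumed   : ∀ {q i k} → prog q ≡ jzdec i p k → x ≡ idle → Control x p after (resume q)

  data Encodes (x : Flag) (W : List Blk) (p : Loc) (c : Counters) : Set where
    encodes : ∀ before {ctl} after → W ≡ before ++ ctl ∷ after → Tokens before → Tokens after →
              Control x p after ctl → Represents c W → Encodes x W p c

  atFront : ∀ {x b w p c} → ¬ IsToken b → Encodes x (b ∷ w) p c →
            Control x p w b × Tokens w × Represents c (b ∷ w)
  atFront _  (encodes [] _ refl _ tw ctl cn)          = ctl , tw , cn
  atFront nt (encodes (_ ∷ _) _ refl (tb ∷ _) _ _ _) = ⊥-elim (nt tb)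

  mainNotQueued : ∀ {x w p c} → ¬ Encodes x (mainB ∷ w) p c
  mainNotQueued e with atFront (λ ()) e
  ... | () , _

  atHandlerFront : ∀ {x q w p c} → Encodes x (handler q ∷ w) p c →
                   q ≡ p × x ≡ idle × Tokens w × Represents c w
  atHandlerFront e with atFront (λ ()) e
  ... | atHandler x≡idle , tw , cn = refl , x≡idle , tw , cn

  control-skip : ∀ {x p v b i} → x ≢ seek i → Control x p v b → Control x p (v ++ [ token i ]) b
  control-skip ne (atHandler x≡idle)   = atHandler x≡idle
  control-skip ne (resumed pe x≡idle)  = resumed pe x≡idle
  control-skip {v = v} {i = i} ne (seeking {i = i'} pe refl z) = seeking pe refl (begin
    count i' (v ++ [ token i ])  ≡⟨ count-snoc i' v (token i) ⟩
    δ i' i + count i' v          ≡⟨ cong₂ _+_ (δ-diff (λ i'≡i → ne (cong seek i'≡i))) z ⟩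
    0                            ∎)
    where open ≡-Reasoning

  rotateToken : ∀ {x i w p c} → x ≢ seek i → Encodes x (token i ∷ w) p c →
                Encodes x (w ++ [ token i ]) p c
  rotateToken ne (encodes [] _ refl _ _ () _)
  rotateToken {i = i} ne (encodes (_ ∷ u) {ctl} v refl (_ ∷ tu) tv ctrl cn) =
    encodes u (v ++ [ token i ]) (++-assoc u (ctl ∷ v) [ token i ]) tu (++⁺ tv (isToken i ∷ []))
      (control-skip ne ctrl) (represents-rotate (token i) (u ++ ctl ∷ v) cn)

  -- a token sought by the flag is consumed: this performs the decrement of M
  consumeToken : ∀ {x i w p c} → x ≡ seek i → Reach p c → Encodes x (token i ∷ w) p c →
                 Progress (Encodes idle w)
  consumeToken x≡seek r (encodes [] _ refl _ _ () _)
  consumeToken x≡seek r (encodes (_ ∷ u) v refl _ _ (atHandler x≡idle) _) =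
    ⊥-elim (seek≢idle (trans (sym x≡seek) x≡idle))
  consumeToken x≡seek r (encodes (_ ∷ u) v refl _ _ (resumed _ x≡idle) _) =
    ⊥-elim (seek≢idle (trans (sym x≡seek) x≡idle))
  consumeToken {i = i} {p = p} {c} x≡seek r
               (encodes (_ ∷ u) v refl (_ ∷ tu) tv (seeking {j = j} pe x≡seek' _) cn)
    with seek-injective (trans (sym x≡seek') x≡seek)
  ... | refl = j , updC c i _ , r ◅◅ (decS pe ci ◅ ε) ,
               encodes u v refl tu tv (resumed pe refl) (represents-removeToken [] i (u ++ resume p ∷ v) cn ci)
    where
    ci : c i ≡ suc (count i (u ++ resume p ∷ v))
    ci = count-token [] i (u ++ resume p ∷ v) cn

  -- resume q meets the flag idle: a token was consumed, M continues at j
  resumeAfterDecrement : ∀ {x q i j k w p c} → prog q ≡ jzdec i j k → x ≡ idle →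
                         Encodes x (resume q ∷ w) p c → Encodes x (w ++ [ handler j ]) p c
  resumeAfterDecrement {j = j} {w = w} pe x≡idle e with atFront (λ ()) e
  ... | seeking _ x≡seek _ , _ = ⊥-elim (seek≢idle (trans (sym x≡seek) x≡idle))
  ... | resumed pe' _ , tw , cn with trans (sym pe) pe'
  ...   | refl = encodes w [] refl tw [] (atHandler x≡idle) (represents-rotate (handler j) w cn)

  -- resume q meets the flag still seeking: counter i is zero, M continues at k
  resumeAtZero : ∀ {x q i j k w p c} → prog q ≡ jzdec i j k → x ≡ seek i → Reach p c →
                 Encodes x (resume q ∷ w) p c → Reach k c × Encodes idle (w ++ [ handler k ]) k c
  resumeAtZero {k = k} {w = w} pe x≡seek r e with atFront (λ ()) e
  ... | resumed _ x≡idle , _ = ⊥-elim (seek≢idle (trans (sym x≡seek) x≡idle))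
  ... | seeking pe' x≡seek' z , tw , cn
    with seek-injective (trans (sym x≡seek') x≡seek) | trans (sym pe) pe'
  ...   | refl | refl = r ◅◅ (zeroS pe (trans (cn _) z) ◅ ε) ,
                        encodes w [] refl tw [] (atHandler refl) (represents-rotate (handler k) w cn)

  haltReached : ∀ {x q w p c} → prog q ≡ halt → Reach p c → Encodes x (handler q ∷ w) p c → Halts M
  haltReached {p = p} {c} pe r e with atHandlerFront e
  ... | refl , _ = p , c , r , pe

  startTest : ∀ {x q i j k w p c} → prog q ≡ jzdec i j k → Encodes x (handler q ∷ w) p c →
              Encodes (seek i) (w ++ [ resume q ]) p c
  startTest {q = q} {w = w} pe e with atHandlerFront e
  ... | refl , _ , tw , cn =
    encodes w [] refl tw [] (seeking pe refl refl) (represents-rotate (resume q) w cn)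

  performInc : ∀ {x q i j w p c} → prog q ≡ inc i j → Reach p c → Encodes x (handler q ∷ w) p c →
               Reach j (updC c i (suc (c i))) ×
               Encodes x ((w ++ [ token i ]) ++ [ handler j ]) j (updC c i (suc (c i)))
  performInc {i = i} {j} {w} pe r e with atHandlerFront e
  ... | refl , x≡idle , tw , cn =
    r ◅◅ (incS pe ◅ ε) ,
    encodes (w ++ [ token i ]) [] refl (++⁺ tw (isToken i ∷ [])) [] (atHandler x≡idle)
      (represents-rotate (handler j) (w ++ [ token i ]) (represents-addToken w i cn))

-- Every reachable configuration either comes after M halted or still encodes a
-- reachable configuration of M; hence covering the target implies halting.
module Soundness (M : CounterMachine) where
  open CounterMachine M using (prog)
  open Construction M
  open QueueWords M

  HandlerRest : Flag → Loc → Instr locs → List Blk → Loc → Counters → Set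
  HandlerRest x q (inc i j)     w p c = Encodes x (w ++ [ handler j ]) p c
  HandlerRest x q (jzdec i j k) w p c = Encodes x (w ++ [ resume q ]) p c
  HandlerRest x q halt          w p c = ⊥

  ZeroTestRest : Instr locs → (Loc → Loc → Set) → Set
  ZeroTestRest (jzdec i j k) P = P j k
  ZeroTestRest (inc _ _)     P = ⊥
  ZeroTestRest halt          P = ⊥

  -- A running serial task is accounted for by the effect it still has to
  -- produce: Core x b s w p c says that the pending queue word w, completed by
  -- what block b does from state s on, encodes (p , c).
  Core : Flag → Blk → St → List Blk → Loc → Counters → Set
  Core x b           s₀ w p c = Encodes x (b ∷ w) p c
  Core x b           s₁ w p c = Encodes x w p c
  Core x (token i)   s₂ w p c = Encodes x (w ++ [ token i ]) p c
  Core x (token i)   s₃ w p c = Encodes idle w p c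
  Core x (handler q) s₂ w p c = HandlerRest x q (prog q) w p c
  Core x (resume q)  s₂ w p c = ZeroTestRest (prog q) λ j k → Encodes x (w ++ [ handler j ]) p c
  Core x (resume q)  s₃ w p c = ZeroTestRest (prog q) λ j k → Encodes idle (w ++ [ handler k ]) p c
  Core x (resume q)  s₄ w p c = ZeroTestRest (prog q) λ j k → Encodes x (w ++ [ handler k ]) p c
  Core _ _           _  _ _ _ = ⊥

  guardCore : ∀ {b s g s' v w p c} → Tr b s (guard g) s' → Sat v g → Reach p c →
              Core (v flag) b s w p c → Progress (Core (v flag) b s' w)
  guardCore mainWait _ _ ()
  guardCore tokenHit (hit ∷ []) r core = consumeToken hit r core
  guardCore tokenMiss (miss ∷ []) r core = _ , _ , r , rotateToken miss core
  guardCore {v = v} {w} {p} {c} (decFound pe) (x≡idle ∷ []) r core =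
    _ , _ , r , subst (λ I → ZeroTestRest I λ j k → Encodes (v flag) (w ++ [ handler j ]) p c)
                      (sym pe) (resumeAfterDecrement pe x≡idle core)
  guardCore {w = w} {c = c} (zeroFound {k = k} pe) (x≡seek ∷ []) r core with resumeAtZero pe x≡seek r core
  ... | r' , e = _ , _ , r' , subst (λ I → ZeroTestRest I λ _ k' → Encodes idle (w ++ [ handler k' ]) k c)
                                    (sym pe) e

  assignCore : ∀ {b s y d s' v w p c} → Tr b s (assign y d) s' → Reach p c → Core (v flag) b s w p c →
               Halts M ⊎ (updV v y d flag ≢ done × Progress (Core (updV v y d flag) b s' w))
  assignCore tokenClear r core      = inj₂ ((λ ()) , _ , _ , r , core)
  assignCore {w = w} {p} {c} (testStart {q} {i} pe) r core =
    inj₂ (seek≢done , _ , _ , r , subst (λ I → HandlerRest (seek i) q I w p c) (sym pe) (startTest pe core))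
  assignCore (haltSignal pe) r core = inj₁ (haltReached pe r core)
  assignCore (zeroClear pe) r core  = inj₂ ((λ ()) , _ , _ , r , core)

  dispatchCore : ∀ {b s q γ s' x w p c} → Tr b s (dispatchA q γ) s' → Reach p c → Core x b s w p c →
                 Σ Blk λ b' → dispatchA q γ ≡ dispatch b' × Progress (Core x b s' (w ++ [ b' ]))
  dispatchCore mainStart _ core       = ⊥-elim (mainNotQueued core)
  dispatchCore tokenRequeue r core    = _ , refl , _ , _ , r , core
  dispatchCore {x = x} {w} (incToken {q} {i} pe) r core with performInc pe r core
  ... | r' , e = token i , refl , _ , _ , r' ,
                 subst (λ I → HandlerRest x q I (w ++ [ token i ]) _ _) (sym pe) e
  dispatchCore {x = x} {w} {p} {c} (incNext {q} {j = j} pe) r core =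
    handler j , refl , _ , _ , r , subst (λ I → HandlerRest x q I w p c) pe core
  dispatchCore {x = x} {w} {p} {c} (testResume {q} pe) r core =
    resume q , refl , _ , _ , r , subst (λ I → HandlerRest x q I w p c) pe core
  dispatchCore {x = x} {w} {p} {c} (decNext {j = j} pe) r core =
    handler j , refl , _ , _ , r ,
    subst (λ I → ZeroTestRest I λ j k → Encodes x (w ++ [ handler j ]) p c) pe core
  dispatchCore {x = x} {w} {p} {c} (zeroNext {k = k} pe) r core =
    handler k , refl , _ , _ , r ,
    subst (λ I → ZeroTestRest I λ j k → Encodes x (w ++ [ handler k ]) p c) pe core

  data Slot : Set where
    empty   : Slot
    running : ℕ → Blk → St → Slot

  tasksOf : Slot → List Task
  tasksOf empty           = mainWaiting ∷ []
  tasksOf (running i b s) = serialTask i b s ∷ mainWaiting ∷ []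

  SlotCore : Flag → Slot → List Blk → Loc → Counters → Set
  SlotCore x empty           w = Encodes x w
  SlotCore x (running _ b s) w = Core x b s w

  record Simulating (v : Valuation) (ts : List Task) (queue : List Call) : Set where
    constructor simulating
    field
      word    : List Blk
      slot    : Slot
      loc     : Loc
      ctrs    : Counters
      queued  : Holds queue word
      tasks   : ts ≡ tasksOf slot
      notDone : v flag ≢ done
      reach   : Reach loc ctrs
      core    : SlotCore (v flag) slot word loc ctrs

  SimulatingAt : Config → Set
  SimulatingAt (cfg v ts qs _) = Simulating v ts (qs serialQ)

  InitialAt : Config → Set
  InitialAt (cfg v ts qs _) = ts ≡ mainTask ∷ [] × qs serialQ ≡ [] × v flag ≡ idle

  Invariant : Config → Set
  Invariant cf = InitialAt cf ⊎ SimulatingAt cf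

  data Acting : List Task → Task → List Task → Slot → Set where
    mainAlone  : Acting [] mainWaiting [] empty
    serialActs : ∀ {i b s} → Acting [] (serialTask i b s) (mainWaiting ∷ []) (running i b s)
    mainBeside : ∀ {i b s} → Acting (serialTask i b s ∷ []) mainWaiting [] (running i b s)

  acting : ∀ xs t ys o → xs ++ t ∷ ys ≡ tasksOf o → Acting xs t ys o
  acting []              _ []      empty           refl = mainAlone
  acting []              _ (_ ∷ _) empty           ()
  acting (_ ∷ [])        _ _       empty           ()
  acting (_ ∷ _ ∷ _)     _ _       empty           ()
  acting []              _ _       (running _ _ _) refl = serialActs
  acting (_ ∷ [])        _ _       (running _ _ _) refl = mainBeside
  acting (_ ∷ _ ∷ [])    _ _       (running _ _ _) ()
  acting (_ ∷ _ ∷ _ ∷ _) _ _       (running _ _ _) ()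

  mainGuard : ∀ {g s' v} → (s₂ , guard g , s') ∈ table mainB → Sat v g → v flag ≡ done
  mainGuard t∈ sat with table→Tr mainB t∈ | sat
  ... | mainWait | v≡done ∷ [] = v≡done

  mainNoAssign : ∀ {y d s'} → ¬ (s₂ , assign y d , s') ∈ table mainB
  mainNoAssign t∈ with table→Tr mainB t∈
  ... | ()

  mainNoDispatch : ∀ {q γ s'} → ¬ (s₂ , dispatchA q γ , s') ∈ table mainB
  mainNoDispatch t∈ with table→Tr mainB t∈
  ... | ()

  s₂≢s₁ : _≢_ {A = St} s₂ s₁
  s₂≢s₁ ()

  s₀≢s₃ : _≢_ {A = St} s₀ s₃
  s₀≢s₃ ()

  idle≢done : _≢_ {A = Flag} idle done
  idle≢done ()

  holds-pop : ∀ {i γ rest w} → Holds (call i γ ∷ rest) w →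
              Σ Blk λ b → Σ (List Blk) λ w' → w ≡ b ∷ w' × γ ≡ code b × Holds rest w'
  holds-pop {w = []} ()
  holds-pop {w = b ∷ w'} e = b , w' , refl , ∷-injectiveˡ e , ∷-injectiveʳ e

  initialActor : ∀ xs t ys → xs ++ t ∷ ys ≡ mainTask ∷ [] → xs ≡ [] × t ≡ mainTask × ys ≡ []
  initialActor []          _ []      refl = refl , refl , refl
  initialActor []          _ (_ ∷ _) ()
  initialActor (_ ∷ [])    _ _       ()
  initialActor (_ ∷ _ ∷ _) _ _       ()

  startSimulation : ∀ {cf cf'} → cf ⟶ cf' → InitialAt cf → SimulatingAt cf'
  startSimulation (dispAStep {xs = xs} {t} {ys} {n = n} _ t∈) (ts≡ , q≡[] , v≡idle)
    with initialActor xs t ys ts≡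
  ... | refl , refl , refl with table→Tr mainB t∈
  ... | mainStart = simulating [ handler zero ] empty zero (λ _ → 0)
          (holds-snoc n (handler zero) (cong (map Call.cblk) q≡[])) refl
          (λ v≡done → idle≢done (trans (sym v≡idle) v≡done)) ε
          (encodes [] [] refl [] [] (atHandler v≡idle) (λ _ → refl))
  startSimulation (guardStep {xs = xs} {t} {ys} _ t∈ _) (ts≡ , _) with initialActor xs t ys ts≡
  ... | refl , refl , refl with table→Tr mainB t∈
  ... | ()
  startSimulation (assignStep {xs = xs} {t} {ys} _ t∈) (ts≡ , _) with initialActor xs t ys ts≡
  ... | refl , refl , refl with table→Tr mainB t∈
  ... | ()
  startSimulation (dispSStep {t = t} _ t∈) _ = ⊥-elim (asynchronous (Task.blk t) t∈ tt)
  startSimulation (removeStep {xs = xs} {t} {ys} _ fin) (ts≡ , _) with initialActor xs t ys ts≡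
  ... | refl , refl , refl with fin
  ... | ()
  startSimulation (deqCStep {c = ()} _) _
  startSimulation (deqSStep {c = zero} q≡ _) (_ , q≡[] , _) with trans (sym q≡[]) q≡
  ... | ()

  stepGuard : ∀ {v xs t ys q g s'} → (Task.st t , guard g , s') ∈ QDAS.trans qdas (Task.blk t) → Sat v g →
              Simulating v (xs ++ t ∷ ys) q → Simulating v (xs ++ setSt t s' ∷ ys) q
  stepGuard {xs = xs} {t} {ys} t∈ sat (simulating w o p c hq ts≡ nd r core) with acting xs t ys o ts≡
  ... | mainAlone  = ⊥-elim (nd (mainGuard t∈ sat))
  ... | mainBeside = ⊥-elim (nd (mainGuard t∈ sat))
  ... | serialActs {i} {b} with guardCore (transitionOf b t∈) sat r core
  ...   | p' , c' , r' , core' = simulating w (running i b _) p' c' hq refl nd r' core'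

  stepAssign : ∀ {v xs t ys q y d s'} → (Task.st t , assign y d , s') ∈ QDAS.trans qdas (Task.blk t) →
               Simulating v (xs ++ t ∷ ys) q → Halts M ⊎ Simulating (updV v y d) (xs ++ setSt t s' ∷ ys) q
  stepAssign {v} {xs} {t} {ys} t∈ (simulating w o p c hq ts≡ nd r core) with acting xs t ys o ts≡
  ... | mainAlone  = ⊥-elim (mainNoAssign t∈)
  ... | mainBeside = ⊥-elim (mainNoAssign t∈)
  ... | serialActs {i} {b} with assignCore {v = v} (transitionOf b t∈) r core
  ...   | inj₁ halts                   = inj₁ halts
  ...   | inj₂ (nd' , p' , c' , r' , core') = inj₂ (simulating w (running i b _) p' c' hq refl nd' r' core')

  stepDispatch : ∀ {v xs t ys qs n q γ s'} →
                 (Task.st t , dispatchA q γ , s') ∈ QDAS.trans qdas (Task.blk t) →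
                 Simulating v (xs ++ t ∷ ys) (qs serialQ) →
                 Simulating v (xs ++ setSt t s' ∷ ys) (enqueue qs q (call n γ) serialQ)
  stepDispatch {xs = xs} {t} {ys} {n = n} t∈ (simulating w o p c hq ts≡ nd r core) with acting xs t ys o ts≡
  ... | mainAlone  = ⊥-elim (mainNoDispatch t∈)
  ... | mainBeside = ⊥-elim (mainNoDispatch t∈)
  ... | serialActs {i} {b} with dispatchCore (transitionOf b t∈) r core
  ...   | b' , refl , p' , c' , r' , core' =
          simulating (w ++ [ b' ]) (running i b _) p' c' (holds-snoc n b' hq) refl nd r' core'

  stepRemove : ∀ {v xs t ys q} → Task.st t ≡ s₁ → Simulating v (xs ++ t ∷ ys) q →
               Simulating v (map (clear (Task.vid t)) (xs ++ ys)) q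
  stepRemove {xs = xs} {t} {ys} fin (simulating w o p c hq ts≡ nd r core) with acting xs t ys o ts≡
  ... | mainAlone  = ⊥-elim (s₂≢s₁ fin)
  ... | mainBeside = ⊥-elim (s₂≢s₁ fin)
  ... | serialActs with fin
  ...   | refl = simulating w empty p c hq refl nd r core

  stepDequeue : ∀ {v ts i γ rest} → All (λ t → src t ≢ just serialQ) ts →
                Simulating v ts (call i γ ∷ rest) → Simulating v (startTask serialQ (call i γ) ∷ ts) rest
  stepDequeue {i = i} {γ} {rest} _ (simulating w empty p c hq refl nd r core) with holds-pop {i} {γ} {rest} {w} hq
  ... | b , w' , refl , refl , hq' = simulating w' (running _ b s₀) p c hq' refl nd r core
  stepDequeue (busy ∷ _) (simulating w (running _ _ _) p c hq refl nd r core) = ⊥-elim (busy refl)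

  preserve : ∀ {cf cf'} → cf ⟶ cf' → Invariant cf → Halts M ⊎ Invariant cf'
  preserve step (inj₁ initial) = inj₂ (inj₂ (startSimulation step initial))
  preserve (guardStep _ t∈ sat) (inj₂ sim) = inj₂ (inj₂ (stepGuard t∈ sat sim))
  preserve (assignStep _ t∈)    (inj₂ sim) with stepAssign t∈ sim
  ... | inj₁ halts = inj₁ halts
  ... | inj₂ sim'  = inj₂ (inj₂ sim')
  preserve (dispAStep {qs = qs} _ t∈) (inj₂ sim) = inj₂ (inj₂ (stepDispatch {qs = qs} t∈ sim))
  preserve (dispSStep {t = t} _ t∈) _      = ⊥-elim (asynchronous (Task.blk t) t∈ tt)
  preserve (removeStep _ fin)   (inj₂ sim) = inj₂ (inj₂ (stepRemove fin sim))
  preserve (deqCStep {c = ()} _) _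
  preserve (deqSStep {c = zero} {k = call _ _} q≡ free) (inj₂ sim) =
    inj₂ (inj₂ (stepDequeue free (subst (Simulating _ _) q≡ sim)))

  invariantAlong : ∀ {cf} → Reachable cf → Halts M ⊎ Invariant cf
  invariantAlong = go (inj₂ (inj₁ (refl , refl , refl)))
    where
    go : ∀ {cf cf'} → Halts M ⊎ Invariant cf → Star _⟶_ cf cf' → Halts M ⊎ Invariant cf'
    go h                ε              = h
    go (inj₁ halts)     (_ ◅ steps)    = go (inj₁ halts) steps
    go (inj₂ inv)       (step ◅ steps) = go (preserve step inv) steps

  NotHalted : Task → Set
  NotHalted t = taskState t ≢ haltedState

  slotNotHalted : ∀ {x o w p c} → SlotCore x o w p c → All NotHalted (tasksOf o)
  slotNotHalted {o = empty}               _    = (λ ()) ∷ []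
  slotNotHalted {o = running i b s} core = serialNotHalted ∷ (λ ()) ∷ []
    where
    serialNotHalted : NotHalted (serialTask i b s)
    serialNotHalted e with code-injective (cong proj₁ e) | cong proj₂ e
    ... | refl | refl = core

  tasksNotHalted : ∀ {v ts qs n} → Invariant (cfg v ts qs n) → All NotHalted ts
  tasksNotHalted (inj₁ (refl , _))                          = (λ ()) ∷ []
  tasksNotHalted (inj₂ (simulating _ o _ _ _ refl _ _ core)) = slotNotHalted {o = o} core

  parikh-halted : ∀ {v ts qs n} → Invariant (cfg v ts qs n) → Parikh (cfg v ts qs n) haltedState ≡ 0
  parikh-halted {v} {ts} {qs} {n} inv =
    cong₂ _+_
      (cong length (filter-none (λ t → taskState t ≟S haltedState) (tasksNotHalted {v} {ts} {qs} {n} inv)))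
      (cong (_+ 0) (cong length (filter-none (λ k → callState k ≟S haltedState) callsNotHalted)))
    where
    callsNotHalted : All (λ k → callState k ≢ haltedState) (qs serialQ)
    callsNotHalted = universal (λ { (call _ _) e → s₀≢s₃ (cong proj₂ e) }) (qs serialQ)

  sound : Coverable target → Halts M
  sound (cfg v ts qs n , reach , covers) with invariantAlong reach
  ... | inj₁ halts = halts
  ... | inj₂ inv   =
    ⊥-elim (ℕₚ.1+n≰n (subst (1 ≤_) (parikh-halted {v} {ts} {qs} {n} inv) (covers haltedState)))

module Completeness (M : CounterMachine) where
  open CounterMachine M using (prog)
  open Construction M
  open QueueWords M
  open CMSem M using (MConf; _↦_; incS; decS; zeroS; updC)

  data BlockRun (b : Blk) : St → Valuation → Valuation → List Blk → Set where
    finish     : ∀ {v} → BlockRun b s₁ v v []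
    guarded    : ∀ {s g s' v v' bs} → Tr b s (guard g) s' → Sat v g → BlockRun b s' v v' bs →
                 BlockRun b s v v' bs
    assigned   : ∀ {s y d s' v v' bs} → Tr b s (assign y d) s' → BlockRun b s' (updV v y d) v' bs →
                 BlockRun b s v v' bs
    dispatched : ∀ {s s' v v' bs} b' → Tr b s (dispatch b') s' → BlockRun b s' v v' bs →
                 BlockRun b s v v' (b' ∷ bs)

  Quiet : Valuation → List Blk → Config → Set
  Quiet v w cf = Σ (Q → List Call) λ qs → Σ ℕ λ n →
                 cf ≡ cfg v (mainWaiting ∷ []) qs n × Holds (qs serialQ) w

  infix 4 _↠_
  record _↠_ (a b : Valuation × List Blk) : Set where
    constructor leads
    field
      follow : ∀ {cf} → Quiet (proj₁ a) (proj₂ a) cf →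
               Σ Config λ cf' → Star _⟶_ cf cf' × Quiet (proj₁ b) (proj₂ b) cf'
  open _↠_

  infixr 5 _⨾_
  _⨾_ : ∀ {a b d} → a ↠ b → b ↠ d → a ↠ d
  follow (f ⨾ g) q with follow f q
  ... | _ , steps₁ , q₁ with follow g q₁
  ...   | cf₂ , steps₂ , q₂ = cf₂ , steps₁ ◅◅ steps₂ , q₂

  ≡⇒↠ : ∀ {v w w'} → w ≡ w' → (v , w) ↠ (v , w')
  follow (≡⇒↠ refl) q = _ , ε , q

  holds-head : ∀ {L b w} → Holds L (b ∷ w) →
               Σ ℕ λ i → Σ (List Call) λ rest → L ≡ call i (code b) ∷ rest × Holds rest w
  holds-head {call i γ ∷ rest} e with ∷-injectiveˡ e
  ... | refl = i , rest , refl , ∷-injectiveʳ e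

  runFrom : ∀ {i b s v v' bs qs n w} → BlockRun b s v v' bs → Holds (qs serialQ) w →
            Σ (Q → List Call) λ qs' → Σ ℕ λ n' →
              Star _⟶_ (cfg v (serialTask i b s ∷ mainWaiting ∷ []) qs n) (cfg v' (mainWaiting ∷ []) qs' n') ×
              Holds (qs' serialQ) (w ++ bs)
  runFrom {w = w} finish hq =
    _ , _ , removeStep {xs = []} refl refl ◅ ε , subst (Holds _) (sym (++-identityʳ w)) hq
  runFrom (guarded t sat run) hq with runFrom run hq
  ... | qs' , n' , steps , hq' = qs' , n' , guardStep {xs = []} refl (memberOf t) sat ◅ steps , hq'
  runFrom (assigned t run) hq with runFrom run hq
  ... | qs' , n' , steps , hq' = qs' , n' , assignStep {xs = []} refl (memberOf t) ◅ steps , hq'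
  runFrom {n = n} {w} (dispatched {bs = bs} b' t run) hq with runFrom run (holds-snoc n b' hq)
  ... | qs' , n' , steps , hq' =
    qs' , n' , dispAStep {xs = []} refl (memberOf t) ◅ steps , subst (Holds _) (++-assoc w [ b' ] bs) hq'

  execute : ∀ {b v v' bs w} → BlockRun b s₀ v v' bs → (v , b ∷ w) ↠ (v' , w ++ bs)
  follow (execute run) (qs , n , refl , hq) with holds-head hq
  ... | i , rest , q≡ , hrest with runFrom {i = i} {qs = setQ qs serialQ rest} {n = n} run hrest
  ... | qs' , n' , steps , hq' =
    _ , deqSStep {c = zero} q≡ ((λ ()) ∷ []) ◅ steps , qs' , n' , refl , hq'

  data Misses (x : Flag) : Blk → Set where
    miss : ∀ {i} → x ≢ seek i → Misses x (token i)

  idleMissesAll : ∀ {x u} → x ≡ idle → Tokens u → All (Misses x) u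
  idleMissesAll x≡idle =
    All.map λ { (isToken i) → miss λ x≡seek → seek≢idle (trans (sym x≡seek) x≡idle) }

  absentMissed : ∀ {x i u} → x ≡ seek i → Tokens u → count i u ≡ 0 → All (Misses x) u
  absentMissed x≡seek [] _ = []
  absentMissed {i = i} x≡seek (isToken j ∷ tu) z =
    miss notSought ∷ absentMissed x≡seek tu (ℕₚ.m+n≡0⇒n≡0 (δ i j) z)
    where
    notSought : _ ≢ seek j
    notSought x≡seek' with seek-injective (trans (sym x≡seek) x≡seek')
    ... | refl = ℕₚ.1+n≢0 (trans (sym (δ-same i)) (ℕₚ.m+n≡0⇒m≡0 (δ i i) z))

  rotate : ∀ {v} u {w} → All (Misses (v flag)) u → (v , u ++ w) ↠ (v , w ++ u)
  rotate [] {w} [] = ≡⇒↠ (sym (++-identityʳ w))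
  rotate (token i ∷ u) {w} (miss m ∷ ms) =
    execute (guarded tokenMiss (m ∷ []) (dispatched (token i) tokenRequeue finish)) ⨾
    ≡⇒↠ (++-assoc u w [ token i ]) ⨾
    rotate u ms ⨾
    ≡⇒↠ (++-assoc w [ token i ] u)

  -- the valuation after a zero test of counter i
  afterTest : Valuation → Fin 2 → Valuation
  afterTest v i = updV (updV v flag (seek i)) flag idle

  simulateInc : ∀ {p i j v w} → prog p ≡ inc i j → v flag ≡ idle → Tokens w →
                (v , handler p ∷ w) ↠ (v , handler j ∷ (w ++ [ token i ]))
  simulateInc {i = i} {j} {w = w} pe x≡idle tw =
    execute (dispatched (token i) (incToken pe) (dispatched (handler j) (incNext pe) finish)) ⨾
    ≡⇒↠ (sym (++-assoc w [ token i ] [ handler j ])) ⨾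
    rotate (w ++ [ token i ]) (idleMissesAll x≡idle (++⁺ tw (isToken i ∷ [])))

  simulateZero : ∀ {p i j k v w} → prog p ≡ jzdec i j k → Tokens w → count i w ≡ 0 →
                 (v , handler p ∷ w) ↠ (afterTest v i , handler k ∷ w)
  simulateZero {p} {k = k} {w = w} pe tw z =
    execute (assigned (testStart pe) (dispatched (resume p) (testResume pe) finish)) ⨾
    rotate w {[ resume p ]} (absentMissed refl tw z) ⨾
    execute (guarded (zeroFound pe) (refl ∷ [])
              (assigned (zeroClear pe) (dispatched (handler k) (zeroNext pe) finish))) ⨾
    rotate w {[ handler k ]} (idleMissesAll refl tw)

  simulateDec : ∀ {p i j k v u u'} → prog p ≡ jzdec i j k → Tokens u → Tokens u' → count i u ≡ 0 →
                (v , handler p ∷ (u ++ token i ∷ u')) ↠ (afterTest v i , handler j ∷ (u ++ u'))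
  simulateDec {p} {i} {j} {u = u} {u'} pe tu tu' z =
    execute (assigned (testStart pe) (dispatched (resume p) (testResume pe) finish)) ⨾
    ≡⇒↠ (++-assoc u (token i ∷ u') [ resume p ]) ⨾
    rotate u (absentMissed refl tu z) ⨾
    execute (guarded tokenHit (refl ∷ []) (assigned tokenClear finish)) ⨾
    ≡⇒↠ (trans (++-identityʳ _) (++-assoc u' [ resume p ] u)) ⨾
    rotate u' {resume p ∷ u} (idleMissesAll refl tu') ⨾
    execute (guarded (decFound pe) (refl ∷ []) (dispatched (handler j) (decNext pe) finish)) ⨾
    rotate (u ++ u') {[ handler j ]} (idleMissesAll refl (++⁺ tu tu'))

  Represented : MConf → Config → Set
  Represented (p , c) cf = Σ Valuation λ v → Σ (List Blk) λ w →
    v flag ≡ idle × Tokens w × Represents c w × Quiet v (handler p ∷ w) cf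

  simulateStep : ∀ {a b cf} → a ↦ b → Represented a cf →
                 Σ Config λ cf' → Star _⟶_ cf cf' × Represented b cf'
  simulateStep (incS {i = i} pe) (v , w , x≡idle , tw , cn , q) with follow (simulateInc pe x≡idle tw) q
  ... | cf' , steps , q' =
    cf' , steps , v , _ , x≡idle , ++⁺ tw (isToken i ∷ []) , represents-addToken w i cn , q'
  simulateStep (zeroS {i = i} pe ci) (v , w , _ , tw , cn , q)
    with follow (simulateZero pe tw (trans (sym (cn i)) ci)) q
  ... | cf' , steps , q' = cf' , steps , afterTest v i , w , refl , tw , cn , q'
  simulateStep (decS {i = i} pe ci) (v , w , _ , tw , cn , q) with firstToken i tw (trans (sym (cn i)) ci)
  ... | u , u' , refl , tu , tu' , z with follow (simulateDec pe tu tu' z) q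
  ... | cf' , steps , q' =
    cf' , steps , afterTest v i , u ++ u' , refl , ++⁺ tu tu' , represents-removeToken u i u' cn ci , q'

  simulate : ∀ {a b cf} → Star _↦_ a b → Represented a cf →
             Σ Config λ cf' → Star _⟶_ cf cf' × Represented b cf'
  simulate ε rep = _ , ε , rep
  simulate (step ◅ steps) rep with simulateStep step rep
  ... | _ , steps₁ , rep₁ with simulate steps rep₁
  ...   | cf₂ , steps₂ , rep₂ = cf₂ , steps₁ ◅◅ steps₂ , rep₂

  startConfig : Config
  startConfig =
    cfg (λ _ → idle) (mainWaiting ∷ []) (enqueue (λ _ → []) serialQ (call 1 (code (handler zero)))) 2

  start : initConfig ⟶ startConfig
  start = dispAStep {xs = []} refl (memberOf mainStart)

  startRepresented : Represented (zero , λ _ → 0) startConfig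
  startRepresented = (λ _ → idle) , [] , refl , [] , (λ _ → refl) , _ , _ , refl , refl

  mainHalted : Task
  mainHalted = record mainTask { st = s₃ }

  covered : ∀ v qs n s → target s ≤ Parikh (cfg v (mainHalted ∷ []) qs n) s
  covered v qs n s with s ≟S haltedState
  ... | yes refl = s≤s z≤n
  ... | no _     = z≤n

  reachHalted : ∀ {p c cf} → prog p ≡ halt → Represented (p , c) cf →
                Σ Config λ cf' → Star _⟶_ cf cf' × (∀ s → target s ≤ Parikh cf' s)
  reachHalted pe (v , w , _ , _ , _ , q) with follow (execute (assigned (haltSignal pe) finish)) q
  ... | _ , steps , qs , n , refl , _ =
    _ , steps ◅◅ (guardStep {xs = []} refl (memberOf mainWait) (refl ∷ []) ◅ ε) ,
    covered (updV v flag done) qs n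

  complete : Halts M → Coverable target
  complete (p , c , reach , pe) with simulate reach startRepresented
  ... | _ , steps , rep with reachHalted pe rep
  ...   | cf' , steps' , covers = cf' , start ◅ (steps ◅◅ steps') , covers

reduction : CounterMachine → Instance
reduction M = record { qdas = qdas ; async = asynchronous ; serial = s≤s z≤n ; target = target }
  where open Construction M

theorem4 : Σ (CounterMachine → Instance) (λ r → ∀ M → Halts M ⇔ InstanceCoverable (r M))
theorem4 = reduction , λ M → mk⇔ (Completeness.complete M) (Soundness.sound M)
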